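{- $\mathsf{EMINCL}$ is strictly less expressive than $\mathsf{MTL}$: every team property expressible in $\mathsf{EMINCL}$ is expressible in $\mathsf{MTL}$, and there is a team property expressible in $\mathsf{MTL}$ that is not expressible in $\mathsf{EMINCL}$.
   Context: Fix a finite nonempty set $X$ of propositional variables. A Kripke model is $M=(W,R,\pi)$ with $W$ a nonempty set, $R\subseteq W\times W$, $\pi\colon X\to 2^W$. A team of $M$ is a set $T\subseteq W$. $\mathsf{ML}$ has syntax $\varphi ::= p\mid\neg p\mid(\varphi\wedge\varphi)\mid(\varphi\vee\varphi)\mid\Diamond\varphi\mid\Box\varphi$, $p\in X$. Team semantics, for $T\subseteq W$ (possibly empty): - $M,T\models p$ iff $T\subseteq\pi(p)$; $M,T\models\neg p$ iff $T\cap\pi(p)=\emptyset$; - $M,T\models\psi\wedge\chi$ iff $M,T\models\psi$ and $M,T\models\chi$; - $M,T\models\psi\vee\chi$ iff $T=T_1\cup T_2$ for some $T_1,T_2$ with $M,T_1\models\psi$ and $M,T_2\models\chi$; - $M,T\models\Diamond\psi$ iff there is a team $T'$ of $M$ with $M,T'\models\psi$ such that each $w\in T$ has some $w'\in T'$ with $(w,w')\in R$ and each $w'\in T'$ has some $w\in T$ with $(w,w')\in R$; - $M,T\models\Box\psi$ iff $M,T'\models\psi$ where $T'=\{w'\in W : (w,w')\in R\text{ for some }w\in T\}$. Each logic below extends the formation rules of $\mathsf{ML}$ (so the new formulas may occur under all connectives of the logic), and in each of them $p,\neg p,\wedge,\vee,\Diamond,\Box$ are interpreted by the team semantics of $\mathsf{ML}$,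 with $\psi,\chi$ ranging over all formulas of that logic. $\mathsf{MTL}$ (modal team logic): adds ${\sim}\psi$, with $M,T\models{\sim}\psi$ iff $M,T\not\models\psi$. $\mathsf{EMINCL}$ (extended modal inclusion logic): adds inclusion atoms $(\varphi_1,\dots,\varphi_n)\subseteq(\psi_1,\dots,\psi_n)$ for $\mathsf{ML}$-formulas $\varphi_i,\psi_i$, with $M,T\models(\varphi_1,\dots,\varphi_n)\subseteq(\psi_1,\dots,\psi_n)$ iff for every $w\in T$ there is $w'\in T$ such that $\varphi_i(w)=\psi_i(w')$ for each $i\in\{1,\dots,n\}$, where $\varphi(w)=1$ if $M,\{w\}\models\varphi$ and $\varphi(w)=0$ otherwise. A team property is a class of pairs $(M,T)$ where $M$ is a Kripke model and $T\neq\emptyset$ is a team of $M$; it is expressible in a logic if for some formula $\varphi$ of the logic it equals the class of all $(M,T)$, $T\neq\emptyset$, with $M,T\models\varphi$. -}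

module Defs where

open import Data.Bool using (Bool; true; false)
open import Data.Nat as ℕ using (ℕ)
open import Data.Product using (_×_; _,_; ∃; ∃-syntax)
open import Data.Vec using (Vec; lookup)
open import Function.Bundles using (_⇔_)
open import Level using (Level; Lift; suc)
open import Relation.Binary using (Rel)
open import Relation.Nullary using (¬_)
open import Relation.Unary using (Pred; _∈_; _⊆_; _∩_; _∪_; _≐_; ｛_｝; Empty; Satisfiable)

record KripkeModel (X : Set) (ℓ : Level) : Set (suc ℓ) where
  field
    W        : Set ℓ
    nonempty : W
    R        : Rel W ℓ
    π        : X → Pred W ℓ

open KripkeModel

private
  variable
    X : Set
    ℓ : Level

Team : KripkeModel X ℓ → Set (suc ℓ)
Team {ℓ = ℓ} M = Pred (W M) ℓ

infixr 7 _∧_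
infixr 6 _∨_
infix  8 ◇_ □_ ∼_

data ML (X : Set) : Set where
  pos neg : X → ML X
  _∧_ _∨_ : ML X → ML X → ML X
  ◇_ □_   : ML X → ML X

data MTL (X : Set) : Set where
  pos neg : X → MTL X
  _∧_ _∨_ : MTL X → MTL X → MTL X
  ◇_ □_   : MTL X → MTL X
  ∼_      : MTL X → MTL X

data EMINCL (X : Set) : Set where
  pos neg : X → EMINCL X
  _∧_ _∨_ : EMINCL X → EMINCL X → EMINCL X
  ◇_ □_   : EMINCL X → EMINCL X
  -- Inclusion atoms; the tuples have length n ≥ 1.
  incl    : ∀ {n} (φs ψs : Vec (ML X) (ℕ.suc n)) → EMINCL X

-- The clauses common to all three logics, as operations on sets of teams.
-- Splitting and ◇ quantify over teams, so satisfaction lives one universe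
-- above the model; Lift only adjusts the level of the literal clauses.
module TeamSemantics {X : Set} {ℓ : Level} (M : KripkeModel X ℓ) where

  ⟦pos⟧ ⟦neg⟧ : X → Pred (Team M) (suc ℓ)
  ⟦pos⟧ p T = Lift (suc ℓ) (T ⊆ π M p)
  ⟦neg⟧ p T = Lift (suc ℓ) (Empty (T ∩ π M p))

  _⟦∧⟧_ _⟦∨⟧_ : (P Q : Pred (Team M) (suc ℓ)) → Pred (Team M) (suc ℓ)
  (P ⟦∧⟧ Q) T = P T × Q T
  (P ⟦∨⟧ Q) T = ∃[ T₁ ] ∃[ T₂ ] T ≐ T₁ ∪ T₂ × P T₁ × Q T₂

  ⟦◇⟧ ⟦□⟧ : Pred (Team M) (suc ℓ) → Pred (Team M) (suc ℓ)
  ⟦◇⟧ P T = ∃[ T′ ] P T′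
    × (∀ w → w ∈ T → ∃[ w′ ] w′ ∈ T′ × R M w w′)
    × (∀ w′ → w′ ∈ T′ → ∃[ w ] w ∈ T × R M w w′)
  ⟦□⟧ P T = P (λ w′ → ∃[ w ] w ∈ T × R M w w′)

open TeamSemantics

-- ML⟦ φ ⟧ M T  is  M,T ⊨ φ,  and likewise for the other two logics.
ML⟦_⟧ : ML X → (M : KripkeModel X ℓ) → Pred (Team M) (suc ℓ)
ML⟦ pos p ⟧ M = ⟦pos⟧ M p
ML⟦ neg p ⟧ M = ⟦neg⟧ M p
ML⟦ φ ∧ ψ ⟧ M = _⟦∧⟧_ M (ML⟦ φ ⟧ M) (ML⟦ ψ ⟧ M)
ML⟦ φ ∨ ψ ⟧ M = _⟦∨⟧_ M (ML⟦ φ ⟧ M) (ML⟦ ψ ⟧ M)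
ML⟦ ◇ φ ⟧   M = ⟦◇⟧ M (ML⟦ φ ⟧ M)
ML⟦ □ φ ⟧   M = ⟦□⟧ M (ML⟦ φ ⟧ M)

MTL⟦_⟧ : MTL X → (M : KripkeModel X ℓ) → Pred (Team M) (suc ℓ)
MTL⟦ pos p ⟧ M   = ⟦pos⟧ M p
MTL⟦ neg p ⟧ M   = ⟦neg⟧ M p
MTL⟦ φ ∧ ψ ⟧ M   = _⟦∧⟧_ M (MTL⟦ φ ⟧ M) (MTL⟦ ψ ⟧ M)
MTL⟦ φ ∨ ψ ⟧ M   = _⟦∨⟧_ M (MTL⟦ φ ⟧ M) (MTL⟦ ψ ⟧ M)
MTL⟦ ◇ φ ⟧   M   = ⟦◇⟧ M (MTL⟦ φ ⟧ M)
MTL⟦ □ φ ⟧   M   = ⟦□⟧ M (MTL⟦ φ ⟧ M)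
MTL⟦ ∼ φ ⟧   M T = ¬ MTL⟦ φ ⟧ M T

-- The graph of the truth-value function:  Value M φ w b  says φ(w) = b.
-- Without excluded middle φ(w) need not exist as an element of Bool, hence
-- the relational form.
Value : (M : KripkeModel X ℓ) → ML X → W M → Bool → Set (suc ℓ)
Value M φ w true  = ML⟦ φ ⟧ M ｛ w ｝
Value M φ w false = ¬ ML⟦ φ ⟧ M ｛ w ｝

EMINCL⟦_⟧ : EMINCL X → (M : KripkeModel X ℓ) → Pred (Team M) (suc ℓ)
EMINCL⟦ pos p ⟧ M = ⟦pos⟧ M p
EMINCL⟦ neg p ⟧ M = ⟦neg⟧ M p
EMINCL⟦ φ ∧ ψ ⟧ M = _⟦∧⟧_ M (EMINCL⟦ φ ⟧ M) (EMINCL⟦ ψ ⟧ M)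
EMINCL⟦ φ ∨ ψ ⟧ M = _⟦∨⟧_ M (EMINCL⟦ φ ⟧ M) (EMINCL⟦ ψ ⟧ M)
EMINCL⟦ ◇ φ ⟧   M = ⟦◇⟧ M (EMINCL⟦ φ ⟧ M)
EMINCL⟦ □ φ ⟧   M = ⟦□⟧ M (EMINCL⟦ φ ⟧ M)
EMINCL⟦ incl φs ψs ⟧ M T =
  ∀ w → w ∈ T → ∃[ w′ ] w′ ∈ T ×
    (∀ i → ∃[ b ] Value M (lookup φs i) w b × Value M (lookup ψs i) w′ b)

record ModelWithTeam (X : Set) (ℓ : Level) : Set (suc ℓ) where
  field
    model    : KripkeModel X ℓ
    team     : Team model
    nonempty : Satisfiable team

TeamProperty : Set → (ℓ : Level) → Set (suc (suc ℓ))
TeamProperty X ℓ = Pred (ModelWithTeam X ℓ) (suc ℓ)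

record Logic (X : Set) (ℓ : Level) : Set (suc (suc ℓ)) where
  field
    Formula : Set
    ⟦_⟧     : Formula → (M : KripkeModel X ℓ) → Pred (Team M) (suc ℓ)

mtl emincl : (X : Set) (ℓ : Level) → Logic X ℓ
mtl    X ℓ = record { Formula = MTL X    ; ⟦_⟧ = MTL⟦_⟧ }
emincl X ℓ = record { Formula = EMINCL X ; ⟦_⟧ = EMINCL⟦_⟧ }

ExpressibleIn : Logic X ℓ → TeamProperty X ℓ → Set (suc ℓ)
ExpressibleIn L P = ∃[ φ ] ∀ MT → P MT ⇔ ⟦ φ ⟧ (model MT) (team MT)
  where
    open Logic L
    open ModelWithTeam

{-# OPTIONS --safe #-}
-- ML is flat, so with a classical metatheory the negation of an ML-formula at
-- worlds is again an ML-formula, its dual, and for each bit vector b some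
-- ML-formula says that the tuple φ⃗ takes the value b nowhere in the team. The
-- atom φ⃗ ⊆ ψ⃗ says that, for each of the finitely many b, if φ⃗ takes the value b
-- in the team, then so does ψ⃗, which is a Boolean combination of such formulas.
-- For strictness, EMINCL is closed under unions of teams, while the property
-- "p is constant on the team" is not.
module Submission where

open import Defs
open import Axiom.ExcludedMiddle using (ExcludedMiddle)
open import Data.Bool using (Bool; true; false; not)
open import Data.Fin using (Fin; zero; suc)
open import Data.Nat using (ℕ; suc)
open import Data.Product using (_×_; _,_; ∃-syntax; proj₁; proj₂)
open import Data.Product.Function.NonDependent.Propositional using (_×-⇔_)
open import Data.Sum using (_⊎_; inj₁; inj₂; [_,_]) renaming (map to map⊎)
open import Data.Unit.Polymorphic using (⊤; tt)
open import Data.Vec using (Vec; []; _∷_; lookup; tabulate)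
open import Data.Vec.Properties using (lookup∘tabulate)
open import Function using (_∘_; id)
open import Function.Bundles using (_↔_; _⇔_; mk⇔; Inverse; Equivalence)
open import Function.Properties.Equivalence using (⇔-isEquivalence)
open import Level using (Level; Lift; lift; lower) renaming (suc to lsuc)
open import Relation.Binary using (IsEquivalence)
open import Relation.Binary.PropositionalEquality
  using (_≡_; refl; sym; cong; cong₂; subst)
open import Relation.Nullary using (¬_; yes; no; contradiction)
open import Relation.Nullary.Decidable using (map′)
open import Relation.Unary using (_∈_; _∪_; _≐_; ｛_｝)

open Equivalence using (to; from)
open TeamSemantics

private
  module ⇔ {a} = IsEquivalence (⇔-isEquivalence {a})

  variable
    X : Set
    ℓ : Level
    n : ℕ

-- Flatness of `ML`.

infix 4 _,_⊩_

-- Kripke semantics at a world. No quantifier over teams occurs, so it stays at level `ℓ` and the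
-- worlds satisfying a formula again form a `Team`.
_,_⊩_ : (M : KripkeModel X ℓ) → KripkeModel.W M → ML X → Set ℓ
M , w ⊩ pos p = KripkeModel.π M p w
M , w ⊩ neg p = ¬ KripkeModel.π M p w
M , w ⊩ φ ∧ ψ = M , w ⊩ φ × M , w ⊩ ψ
M , w ⊩ φ ∨ ψ = M , w ⊩ φ ⊎ M , w ⊩ ψ
M , w ⊩ ◇ φ   = ∃[ v ] KripkeModel.R M w v × M , v ⊩ φ
M , w ⊩ □ φ   = ∀ v → KripkeModel.R M w v → M , v ⊩ φ

-- From right to left the witnesses are the largest possible: for `∨`, all worlds of `T` satisfying
-- each disjunct; for `◇`, all successors of `T` satisfying `φ`. Thus nothing has to be decided or
-- chosen.
flat : (M : KripkeModel X ℓ) (φ : ML X) (T : Team M) →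
  ML⟦ φ ⟧ M T ⇔ (∀ w → w ∈ T → M , w ⊩ φ)
flat M (pos p) T = mk⇔ (λ h w w∈T → lower h w∈T) (λ h → lift λ {w} → h w)
flat M (neg p) T =
  mk⇔ (λ h w w∈T πw → lower h w (w∈T , πw)) (λ h → lift λ w (w∈T , πw) → h w w∈T πw)
flat M (φ ∧ ψ) T = mk⇔
  (λ (h , k) w w∈T → to (flat M φ T) h w w∈T , to (flat M ψ T) k w w∈T)
  (λ h → from (flat M φ T) (λ w → proj₁ ∘ h w) , from (flat M ψ T) (λ w → proj₂ ∘ h w))
flat M (φ ∨ ψ) T = mk⇔
  (λ (T₁ , T₂ , T≐ , h , k) w w∈T →
    map⊎ (to (flat M φ T₁) h w) (to (flat M ψ T₂) k w) (proj₁ T≐ w∈T))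
  (λ h → (λ w → w ∈ T × M , w ⊩ φ) , (λ w → w ∈ T × M , w ⊩ ψ)
    , ((λ {w} w∈T → map⊎ (w∈T ,_) (w∈T ,_) (h w w∈T)) , λ {w} → [ proj₁ , proj₁ ])
    , from (flat M φ _) (λ w → proj₂) , from (flat M ψ _) (λ w → proj₂))
flat M (◇ φ) T = mk⇔
  (λ (T′ , h , forth , _) w w∈T → let (v , v∈T′ , Rwv) = forth w w∈T in
    v , Rwv , to (flat M φ T′) h v v∈T′)
  (λ (h : ∀ w → w ∈ T → M , w ⊩ ◇ φ) →
    (λ v → (∃[ w ] w ∈ T × KripkeModel.R M w v) × M , v ⊩ φ)
    , from (flat M φ _) (λ v → proj₂)
    , (λ w w∈T → let (v , Rwv , v⊩φ) = h w w∈T in v , ((w , w∈T , Rwv) , v⊩φ) , Rwv)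
    , (λ v → proj₁))
flat M (□ φ) T = mk⇔
  (λ h w w∈T v Rwv → to (flat M φ _) h v (w , w∈T , Rwv))
  (λ h → from (flat M φ _) (λ v (w , w∈T , Rwv) → h w w∈T v Rwv))

flat-｛｝ : (M : KripkeModel X ℓ) (φ : ML X) (w : KripkeModel.W M) →
  ML⟦ φ ⟧ M ｛ w ｝ ⇔ M , w ⊩ φ
flat-｛｝ M φ w = mk⇔
  (λ h → to (flat M φ ｛ w ｝) h w refl)
  (λ h → from (flat M φ ｛ w ｝) λ { _ refl → h })

Value-unique : (M : KripkeModel X ℓ) (φ : ML X) (w : KripkeModel.W M) (b c : Bool) →
  Value M φ w b → Value M φ w c → b ≡ c
Value-unique M φ w true  true  h k = refl
Value-unique M φ w true  false h k = contradiction h k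
Value-unique M φ w false true  h k = contradiction k h
Value-unique M φ w false false h k = refl

Values : (M : KripkeModel X ℓ) → Vec (ML X) n → KripkeModel.W M → Vec Bool n → Set (lsuc ℓ)
Values M φs w bs = ∀ i → Value M (lookup φs i) w (lookup bs i)

-- Translation of `EMINCL` into `MTL`.

ML⇒MTL : ML X → MTL X
ML⇒MTL (pos p) = pos p
ML⇒MTL (neg p) = neg p
ML⇒MTL (φ ∧ ψ) = ML⇒MTL φ ∧ ML⇒MTL ψ
ML⇒MTL (φ ∨ ψ) = ML⇒MTL φ ∨ ML⇒MTL ψ
ML⇒MTL (◇ φ)   = ◇ ML⇒MTL φ
ML⇒MTL (□ φ)   = □ ML⇒MTL φ

-- Both semantics apply the same operations to sets of teams, so the predicates are propositionally
-- equal, by congruence alone.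
ML⇒MTL-⟦⟧ : (M : KripkeModel X ℓ) (φ : ML X) → MTL⟦ ML⇒MTL φ ⟧ M ≡ ML⟦ φ ⟧ M
ML⇒MTL-⟦⟧ M (pos p) = refl
ML⇒MTL-⟦⟧ M (neg p) = refl
ML⇒MTL-⟦⟧ M (φ ∧ ψ) = cong₂ (_⟦∧⟧_ M) (ML⇒MTL-⟦⟧ M φ) (ML⇒MTL-⟦⟧ M ψ)
ML⇒MTL-⟦⟧ M (φ ∨ ψ) = cong₂ (_⟦∨⟧_ M) (ML⇒MTL-⟦⟧ M φ) (ML⇒MTL-⟦⟧ M ψ)
ML⇒MTL-⟦⟧ M (◇ φ)   = cong (⟦◇⟧ M) (ML⇒MTL-⟦⟧ M φ)
ML⇒MTL-⟦⟧ M (□ φ)   = cong (⟦□⟧ M) (ML⇒MTL-⟦⟧ M φ)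

-- Negation at each world, not of the team: on a team `dual φ` makes `φ` fail everywhere, whereas
-- `∼` only denies that it holds everywhere.
dual : ML X → ML X
dual (pos p) = neg p
dual (neg p) = pos p
dual (φ ∧ ψ) = dual φ ∨ dual ψ
dual (φ ∨ ψ) = dual φ ∧ dual ψ
dual (◇ φ)   = □ dual φ
dual (□ φ)   = ◇ dual φ

signed : Bool → ML X → ML X
signed true  φ = φ
signed false φ = dual φ

-- At a world `∨` is Boolean, so this says that some coordinate disagrees with `bs`. Tuples are
-- nonempty, so the recursion stops at length one, without a formula for falsity.
differs : Vec (ML X) (suc n) → Vec Bool (suc n) → ML X
differs (φ ∷ [])         (b ∷ [])         = signed (not b) φ
differs (φ ∷ φs@(_ ∷ _)) (b ∷ bs@(_ ∷ _)) = signed (not b) φ ∨ differs φs bs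

⋀ : ∀ n → (Vec Bool n → MTL X) → MTL X
⋀ 0       f = f []
⋀ (suc n) f = ⋀ n (f ∘ (true ∷_)) ∧ ⋀ n (f ∘ (false ∷_))

⋀-⟦⟧ : (M : KripkeModel X ℓ) (T : Team M) → ∀ n (f : Vec Bool n → MTL X) →
  MTL⟦ ⋀ n f ⟧ M T ⇔ (∀ bs → MTL⟦ f bs ⟧ M T)
⋀-⟦⟧ M T 0       f = mk⇔ (λ { h [] → h }) (λ h → h [])
⋀-⟦⟧ M T (suc n) f = mk⇔
  (λ { (h , k) (true  ∷ bs) → to (⋀-⟦⟧ M T n _) h bs
     ; (h , k) (false ∷ bs) → to (⋀-⟦⟧ M T n _) k bs })
  (λ h → from (⋀-⟦⟧ M T n _) (h ∘ (true ∷_)) , from (⋀-⟦⟧ M T n _) (h ∘ (false ∷_)))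

-- An implication in De Morgan form, because `∨` splits the team and is not Boolean disjunction. `∼`
-- before `differs` says that the value is attained somewhere.
attained⇒attained : (φs ψs : Vec (ML X) (suc n)) → Vec Bool (suc n) → MTL X
attained⇒attained φs ψs bs = ∼ (∼ ML⇒MTL (differs φs bs) ∧ ML⇒MTL (differs ψs bs))

EMINCL⇒MTL : EMINCL X → MTL X
EMINCL⇒MTL (pos p) = pos p
EMINCL⇒MTL (neg p) = neg p
EMINCL⇒MTL (φ ∧ ψ) = EMINCL⇒MTL φ ∧ EMINCL⇒MTL ψ
EMINCL⇒MTL (φ ∨ ψ) = EMINCL⇒MTL φ ∨ EMINCL⇒MTL ψ
EMINCL⇒MTL (◇ φ)   = ◇ EMINCL⇒MTL φ
EMINCL⇒MTL (□ φ)   = □ EMINCL⇒MTL φ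
EMINCL⇒MTL (incl φs ψs) = ⋀ _ (attained⇒attained φs ψs)

-- Correctness of the translation.

module _ {ℓ} (em : ExcludedMiddle (lsuc ℓ)) where

  -- Truth at a world lives at level `ℓ`, one below satisfaction by teams, and both levels need
  -- decisions.
  lower-em : ExcludedMiddle ℓ
  lower-em = map′ lower lift (em {Lift (lsuc ℓ) _})

  dne : {A : Set ℓ} → ¬ ¬ A → A
  dne {A} h with lower-em {A}
  ... | yes a = a
  ... | no ¬a = contradiction ¬a h

  -- Right to left is classical: `neg`, `∧` and `□` each eliminate a double negation.
  ⊩-dual : (M : KripkeModel X ℓ) (φ : ML X) (w : KripkeModel.W M) →
    M , w ⊩ dual φ ⇔ (¬ M , w ⊩ φ)
  ⊩-dual M (pos p) w = ⇔.refl
  ⊩-dual M (neg p) w = mk⇔ (λ h k → k h) dne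
  ⊩-dual M (φ ∧ ψ) w = mk⇔
    (λ h (k , l) → [ (λ d → to (⊩-dual M φ w) d k) , (λ d → to (⊩-dual M ψ w) d l) ] h)
    (λ h → dne λ ¬d → ¬d (inj₁ (from (⊩-dual M φ w) λ k →
      ¬d (inj₂ (from (⊩-dual M ψ w) λ l → h (k , l))))))
  ⊩-dual M (φ ∨ ψ) w = mk⇔
    (λ (h , k) → [ to (⊩-dual M φ w) h , to (⊩-dual M ψ w) k ])
    (λ h → from (⊩-dual M φ w) (h ∘ inj₁) , from (⊩-dual M ψ w) (h ∘ inj₂))
  ⊩-dual M (◇ φ) w = mk⇔
    (λ h (v , Rwv , k) → to (⊩-dual M φ v) (h v Rwv) k)
    (λ h v Rwv → from (⊩-dual M φ v) λ k → h (v , Rwv , k))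
  ⊩-dual M (□ φ) w = mk⇔
    (λ (v , Rwv , h) k → to (⊩-dual M φ v) h (k v Rwv))
    (λ h → dne λ ¬d → h λ v Rwv → dne λ ¬k → ¬d (v , Rwv , from (⊩-dual M φ v) ¬k))

  ⊩-signed-not : (M : KripkeModel X ℓ) (φ : ML X) (w : KripkeModel.W M) (b : Bool) →
    M , w ⊩ signed (not b) φ ⇔ (¬ Value M φ w b)
  ⊩-signed-not M φ w true  = mk⇔
    (λ d → to (⊩-dual M φ w) d ∘ to (flat-｛｝ M φ w))
    (λ h → from (⊩-dual M φ w) (h ∘ from (flat-｛｝ M φ w)))
  ⊩-signed-not M φ w false = mk⇔
    (λ h k → k (from (flat-｛｝ M φ w) h))
    (λ h → dne λ ¬k → h (¬k ∘ to (flat-｛｝ M φ w)))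

  ⊩-differs : (M : KripkeModel X ℓ) (φs : Vec (ML X) (suc n)) (bs : Vec Bool (suc n))
    (w : KripkeModel.W M) → M , w ⊩ differs φs bs ⇔ (¬ Values M φs w bs)
  ⊩-differs M (φ ∷ []) (b ∷ []) w = mk⇔
    (λ h vs → to (⊩-signed-not M φ w b) h (vs zero))
    (λ h → from (⊩-signed-not M φ w b) λ v → h λ { zero → v })
  ⊩-differs M (φ ∷ φs@(_ ∷ _)) (b ∷ bs@(_ ∷ _)) w = mk⇔
    (λ h vs → [ (λ d → to (⊩-signed-not M φ w b) d (vs zero))
              , (λ d → to (⊩-differs M φs bs w) d (vs ∘ suc)) ] h)
    (λ h → dne λ ¬d → ¬d (inj₁ (from (⊩-signed-not M φ w b) λ v →
      ¬d (inj₂ (from (⊩-differs M φs bs w) λ vs →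
        h λ { zero → v ; (suc i) → vs i })))))

  MTL-differs : (M : KripkeModel X ℓ) (φs : Vec (ML X) (suc n)) (bs : Vec Bool (suc n))
    (T : Team M) →
    MTL⟦ ML⇒MTL (differs φs bs) ⟧ M T ⇔ (∀ w → w ∈ T → ¬ Values M φs w bs)
  MTL-differs M φs bs T rewrite ML⇒MTL-⟦⟧ M (differs φs bs) = mk⇔
    (λ h w w∈T → to (⊩-differs M φs bs w) (to (flat M (differs φs bs) T) h w w∈T))
    (λ h → from (flat M (differs φs bs) T) λ w w∈T → from (⊩-differs M φs bs w) (h w w∈T))

  value : (M : KripkeModel X ℓ) (φ : ML X) (w : KripkeModel.W M) → ∃[ b ] Value M φ w b
  value M φ w with em {ML⟦ φ ⟧ M ｛ w ｝}
  ... | yes h = true , h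
  ... | no ¬h = false , ¬h

  values : (M : KripkeModel X ℓ) (φs : Vec (ML X) n) (w : KripkeModel.W M) →
    ∃[ bs ] Values M φs w bs
  values M φs w = tabulate (λ i → proj₁ (value M (lookup φs i) w)) , λ i →
    subst (Value M (lookup φs i) w) (sym (lookup∘tabulate _ i)) (proj₂ (value M (lookup φs i) w))

  EMINCL⇒MTL-⟦⟧ : (M : KripkeModel X ℓ) (φ : EMINCL X) (T : Team M) →
    EMINCL⟦ φ ⟧ M T ⇔ MTL⟦ EMINCL⇒MTL φ ⟧ M T
  EMINCL⇒MTL-⟦⟧ M (pos p) T = ⇔.refl
  EMINCL⇒MTL-⟦⟧ M (neg p) T = ⇔.refl
  EMINCL⇒MTL-⟦⟧ M (φ ∧ ψ) T = EMINCL⇒MTL-⟦⟧ M φ T ×-⇔ EMINCL⇒MTL-⟦⟧ M ψ T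
  EMINCL⇒MTL-⟦⟧ M (φ ∨ ψ) T = mk⇔
    (λ (T₁ , T₂ , T≐ , h , k) →
      T₁ , T₂ , T≐ , to (EMINCL⇒MTL-⟦⟧ M φ T₁) h , to (EMINCL⇒MTL-⟦⟧ M ψ T₂) k)
    (λ (T₁ , T₂ , T≐ , h , k) →
      T₁ , T₂ , T≐ , from (EMINCL⇒MTL-⟦⟧ M φ T₁) h , from (EMINCL⇒MTL-⟦⟧ M ψ T₂) k)
  EMINCL⇒MTL-⟦⟧ M (◇ φ) T = mk⇔
    (λ (T′ , h , fb) → T′ , to (EMINCL⇒MTL-⟦⟧ M φ T′) h , fb)
    (λ (T′ , h , fb) → T′ , from (EMINCL⇒MTL-⟦⟧ M φ T′) h , fb)
  EMINCL⇒MTL-⟦⟧ M (□ φ) T = EMINCL⇒MTL-⟦⟧ M φ _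
  EMINCL⇒MTL-⟦⟧ M (incl φs ψs) T =
    ⇔.trans (mk⇔ preserve match) (⇔.sym (⋀-⟦⟧ M T _ (attained⇒attained φs ψs)))
    where
    preserve : EMINCL⟦ incl φs ψs ⟧ M T → ∀ bs → MTL⟦ attained⇒attained φs ψs bs ⟧ M T
    preserve h bs (φ≈bs , ψ≉bs) = φ≈bs (from (MTL-differs M φs bs T) λ w w∈T φw≡bs →
      let (v , v∈T , φw≡ψv) = h w w∈T in
      to (MTL-differs M ψs bs T) ψ≉bs v v∈T λ i →
        -- The atom brings its own bit `c` for each coordinate; uniqueness of values identifies it
        -- with that of `bs`.
        let (c , φwᵢ≡c , ψvᵢ≡c) = φw≡ψv i in
        subst (Value M (lookup ψs i) v)
          (Value-unique M (lookup φs i) w c (lookup bs i) φwᵢ≡c (φw≡bs i)) ψvᵢ≡c)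

    match : (∀ bs → MTL⟦ attained⇒attained φs ψs bs ⟧ M T) → EMINCL⟦ incl φs ψs ⟧ M T
    match h w w∈T with values M φs w
    -- The translated atom only refutes the absence of a matching world, so its existence is decided
    -- first.
    ... | bs , φw≡bs with em {∃[ v ] v ∈ T × Values M ψs v bs}
    ... | yes (v , v∈T , ψv≡bs) = v , v∈T , λ i → lookup bs i , φw≡bs i , ψv≡bs i
    ... | no ∄v = contradiction
      ( (λ φ≉bs → to (MTL-differs M φs bs T) φ≉bs w w∈T φw≡bs)
      , from (MTL-differs M ψs bs T) (λ v v∈T ψv≡bs → ∄v (v , v∈T , ψv≡bs)))
      (h bs)

-- Union closure and strictness.

-- Stated up to ≐, so that the induction goes through □ without extensionality.
EMINCL-∪-closed : (M : KripkeModel X ℓ) (φ : EMINCL X) {T T₁ T₂ : Team M} →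
  T ≐ T₁ ∪ T₂ → EMINCL⟦ φ ⟧ M T₁ → EMINCL⟦ φ ⟧ M T₂ → EMINCL⟦ φ ⟧ M T
EMINCL-∪-closed M (pos p) T≐ h k = lift ([ lower h , lower k ] ∘ proj₁ T≐)
EMINCL-∪-closed M (neg p) T≐ h k = lift λ w (w∈T , πw) →
  [ (λ w∈T₁ → lower h w (w∈T₁ , πw)) , (λ w∈T₂ → lower k w (w∈T₂ , πw)) ] (proj₁ T≐ w∈T)
EMINCL-∪-closed M (φ ∧ ψ) T≐ (h₁ , h₂) (k₁ , k₂) =
  EMINCL-∪-closed M φ T≐ h₁ k₁ , EMINCL-∪-closed M ψ T≐ h₂ k₂
EMINCL-∪-closed M (φ ∨ ψ) T≐ (A , B , T₁≐ , hA , hB) (A′ , B′ , T₂≐ , kA , kB) =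
  -- The two splittings are merged componentwise.
  A ∪ A′ , B ∪ B′
  , ( [ map⊎ inj₁ inj₁ ∘ proj₁ T₁≐ , map⊎ inj₂ inj₂ ∘ proj₁ T₂≐ ] ∘ proj₁ T≐
    , proj₂ T≐ ∘ [ map⊎ (proj₂ T₁≐ ∘ inj₁) (proj₂ T₂≐ ∘ inj₁)
                 , map⊎ (proj₂ T₁≐ ∘ inj₂) (proj₂ T₂≐ ∘ inj₂) ] )
  , EMINCL-∪-closed M φ (id , id) hA kA , EMINCL-∪-closed M ψ (id , id) hB kB
EMINCL-∪-closed M (◇ φ) T≐ (T₁′ , h , forth₁ , back₁) (T₂′ , k , forth₂ , back₂) =
  T₁′ ∪ T₂′ , EMINCL-∪-closed M φ (id , id) h k
  , (λ w w∈T → [ (λ w∈T₁ → let (v , v∈ , Rwv) = forth₁ w w∈T₁ in v , inj₁ v∈ , Rwv)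
               , (λ w∈T₂ → let (v , v∈ , Rwv) = forth₂ w w∈T₂ in v , inj₂ v∈ , Rwv)
               ] (proj₁ T≐ w∈T))
  , (λ v → [ (λ v∈ → let (w , w∈ , Rwv) = back₁ v v∈ in w , proj₂ T≐ (inj₁ w∈) , Rwv)
           , (λ v∈ → let (w , w∈ , Rwv) = back₂ v v∈ in w , proj₂ T≐ (inj₂ w∈) , Rwv) ])
EMINCL-∪-closed M (□ φ) T≐ = EMINCL-∪-closed M φ
  ( (λ (w , w∈T , Rwv) → map⊎ (λ w∈ → w , w∈ , Rwv) (λ w∈ → w , w∈ , Rwv) (proj₁ T≐ w∈T))
  , [ (λ (w , w∈ , Rwv) → w , proj₂ T≐ (inj₁ w∈) , Rwv)
    , (λ (w , w∈ , Rwv) → w , proj₂ T≐ (inj₂ w∈) , Rwv) ])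
EMINCL-∪-closed M (incl φs ψs) T≐ h k w w∈T =
  [ (λ w∈ → let (v , v∈ , φw≡ψv) = h w w∈ in v , proj₂ T≐ (inj₁ v∈) , φw≡ψv)
  , (λ w∈ → let (v , v∈ , φw≡ψv) = k w w∈ in v , proj₂ T≐ (inj₂ v∈) , φw≡ψv) ] (proj₁ T≐ w∈T)

-- The Boolean disjunction of `pos p` and `neg p`. The splitting disjunction would classically hold
-- in every team.
constancy : X → MTL X
constancy p = ∼ (∼ pos p ∧ ∼ neg p)

-- Each variable separates the two worlds, so constancy holds on both singletons but fails on their
-- union.
twoWorlds : (X : Set) (ℓ : Level) → KripkeModel X ℓ
twoWorlds X ℓ = record
  { W        = Lift ℓ Bool
  ; nonempty = lift true
  ; R        = _≡_
  ; π        = λ _ → ｛ lift true ｝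
  }

constancy-inexpressible : (p : X) →
  ¬ ExpressibleIn (emincl X ℓ) (λ MT →
    MTL⟦ constancy p ⟧ (ModelWithTeam.model MT) (ModelWithTeam.team MT))
constancy-inexpressible {X} {ℓ} p (φ , φ-expresses) =
  from (φ-expresses everything) everything⊨φ
    ( (λ h → contradiction (lower h {lift false} tt) λ ())
    , (λ h → lower h (lift true) (tt , refl)))
  where
  M = twoWorlds X ℓ

  everything : ModelWithTeam X ℓ
  everything = record { model = M ; team = λ _ → ⊤ ; nonempty = lift true , tt }

  singleton : Bool → ModelWithTeam X ℓ
  singleton b = record { model = M ; team = ｛ lift b ｝ ; nonempty = lift b , refl }

  everything⊨φ : EMINCL⟦ φ ⟧ M (λ _ → ⊤)
  everything⊨φ = EMINCL-∪-closed M φ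
    ((λ { {lift true} _ → inj₁ refl ; {lift false} _ → inj₂ refl }) , (λ _ → tt))
    (to (φ-expresses (singleton true)) λ (¬pos , _) → ¬pos (lift λ { refl → refl }))
    (to (φ-expresses (singleton false)) λ (_ , ¬neg) → ¬neg (lift λ { _ (refl , ()) }))

theorem4p3 : (ℓ : Level) → ExcludedMiddle (lsuc ℓ) →
    (X : Set) (n : ℕ) → X ↔ Fin (suc n) →
    (∀ (P : TeamProperty X ℓ) → ExpressibleIn (emincl X ℓ) P → ExpressibleIn (mtl X ℓ) P)
    × (∃[ P ] (ExpressibleIn (mtl X ℓ) P × ¬ ExpressibleIn (emincl X ℓ) P))
theorem4p3 ℓ em X n X↔Fin =
  (λ P (φ , φ-expresses) → EMINCL⇒MTL φ , λ MT →
    ⇔.trans (φ-expresses MT) (EMINCL⇒MTL-⟦⟧ em (ModelWithTeam.model MT) φ (ModelWithTeam.team MT)))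
  -- The property is the one defined by `constancy p` itself; unification finds it.
  , _ , (constancy p , λ _ → ⇔.refl) , constancy-inexpressible p
  where
  p : X
  p = Inverse.from X↔Fin zero
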